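{- Let $\mathcal A=(S,R_0)$ be an argumentation network with joint attacks, where $S\neq\varnothing$ and $R_0\subseteq(2^S\setminus\{\varnothing\})\times S$. Then there exists a legitimate Caminada–Gabbay labelling $\lambda$ of $\mathcal A$ (i.e. $\mathcal A$ has complete extensions).
   Context: A legitimate Caminada–Gabbay labelling of $(S,R_0)$ is $\lambda:S\to\{\mathrm{in},\mathrm{out},\mathrm{und}\}$ such that for each $x\in S$: (CG1) $\lambda(x)=\mathrm{in}$ iff either $x$ is attacked by no $G$, or for every $G$ with $GR_0x$ there is $y\in G$ with $\lambda(y)=\mathrm{out}$; (CG2) $\lambda(x)=\mathrm{out}$ iff for some $G$ with $GR_0x$, all $y\in G$ have $\lambda(y)=\mathrm{in}$; (CG3) $\lambda(x)=\mathrm{und}$ iff for every $G$ with $GR_0x$ there is $y\in G$ with $\lambda(y)\neq\mathrm{in}$, and for some $G'$ with $G'R_0x$ every $y\in G'$ has $\lambda(y)\in\{\mathrm{in},\mathrm{und}\}$. Complete extensions are identified with legitimate Caminada–Gabbay labellings. -}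

module Defs where

open import Level using (Level; _⊔_; suc)
open import Data.Product using (∃-syntax; _×_)
open import Data.Sum using (_⊎_)
open import Function.Bundles using (_⇔_)
open import Relation.Binary.Core using (REL)
open import Relation.Binary.PropositionalEquality using (_≡_; _≢_)
open import Relation.Nullary using (¬_)
open import Relation.Unary using (Pred; _∈_; _≐_; Satisfiable)

private
  variable
    a ℓ r : Level

-- S may be infinite, and R₀ need not be decidable.
record JointAttackNetwork (a ℓ r : Level) : Set (suc (a ⊔ ℓ ⊔ r)) where
  field
    S          : Set a
    S-nonempty : S
    R₀         : REL (Pred S ℓ) S r
    R₀-nonempty : ∀ {G x} → R₀ G x → Satisfiable G
    -- Subsets of S are predicates, whose equality as sets is _≐_; a relation on
    -- the power set must not distinguish predicates with the same elements.
    R₀-resp-≐ : ∀ {G H x} → G ≐ H → R₀ G x → R₀ H x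

data Label : Set where
  inn out und : Label

module _ (𝒜 : JointAttackNetwork a ℓ r) where
  open JointAttackNetwork 𝒜

  Labelling : Set a
  Labelling = S → Label

  record IsLegitimate (lab : Labelling) : Set (a ⊔ suc ℓ ⊔ r) where
    field
      CG1 : ∀ x → lab x ≡ inn ⇔
              ( (¬ (∃[ G ] R₀ G x))
              ⊎ (∀ G → R₀ G x → ∃[ y ] (y ∈ G × lab y ≡ out)) )
      CG2 : ∀ x → lab x ≡ out ⇔
              (∃[ G ] (R₀ G x × (∀ y → y ∈ G → lab y ≡ inn)))
      CG3 : ∀ x → lab x ≡ und ⇔
              ( (∀ G → R₀ G x → ∃[ y ] (y ∈ G × lab y ≢ inn))
              × (∃[ G′ ] (R₀ G′ x × (∀ y → y ∈ G′ → lab y ≡ inn ⊎ lab y ≡ und))) )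

-- The grounded extension: the least solution of "x is in when every attacking
-- set has an out element, x is out when some attacking set is entirely in" is
-- inductively defined, its two halves are disjoint by induction, and everything
-- in neither half is labelled undecided.
module Submission where

open import Defs
open import Level using (Level; Lift; lift; lower; _⊔_; suc)
open import Axiom.ExcludedMiddle using (ExcludedMiddle)
open import Axiom.DoubleNegationElimination using (DoubleNegationElimination; em⇒dne)
open import Data.Product using (∃-syntax; _×_; _,_)
open import Data.Sum using (_⊎_; inj₁; inj₂)
open import Function.Base using (_∘_)
open import Function.Bundles using (mk⇔)
open import Relation.Binary.PropositionalEquality using (_≡_; _≢_; refl; sym; trans)
open import Relation.Nullary using (¬_; Dec; yes; no; contradiction)
open import Relation.Nullary.Decidable using (map′)
open import Relation.Unary using (_∈_)

lower-em : ∀ {p} q → ExcludedMiddle (p ⊔ q) → ExcludedMiddle p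
lower-em q em {P} = map′ lower lift (em {Lift q P})

module Grounded {a ℓ r : Level} (𝒜 : JointAttackNetwork a ℓ r) where
  open JointAttackNetwork 𝒜

  -- An unattacked point needs no constructor of its own: it satisfies the premise of `defended`
  -- vacuously.
  data In  : S → Set (a ⊔ suc ℓ ⊔ r)
  data Out : S → Set (a ⊔ suc ℓ ⊔ r)

  data In where
    defended : ∀ {x} → (∀ G → R₀ G x → ∃[ y ] (y ∈ G × Out y)) → In x

  data Out where
    defeated : ∀ {x} G → R₀ G x → (∀ y → y ∈ G → In y) → Out x

  -- A clash at `x` produces a clash at some `y` in the defeating set `G`, built from strict
  -- subderivations of both proofs. Derivations are well founded, so this descent stops even when
  -- `S` is infinite.
  In-Out-disjoint : ∀ {x} → In x → ¬ Out x
  In-Out-disjoint (defended f) (defeated G Gx g) with f G Gx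
  ... | y , y∈G , out-y = In-Out-disjoint (g y y∈G) out-y

  module _ (em : ExcludedMiddle (a ⊔ suc ℓ ⊔ r)) where

    private
      dne : DoubleNegationElimination (a ⊔ suc ℓ ⊔ r)
      dne = em⇒dne em

      -- Existentials over members of `G` that speak only of labels avoid `R₀`, `In` and `Out`, so
      -- they live at this smaller level.
      dne-small : DoubleNegationElimination (a ⊔ ℓ)
      dne-small = em⇒dne (lower-em (suc ℓ ⊔ r) em)

    label : ∀ {x} → Dec (In x) → Dec (Out x) → Label
    label (yes _) _       = inn
    label (no _)  (yes _) = out
    label (no _)  (no _)  = und

    lab : Labelling 𝒜
    lab x = label {x} em em

    In⇒inn : ∀ {x} → In x → lab x ≡ inn
    In⇒inn {x} i with em {In x}
    ... | yes _ = refl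
    ... | no ¬i = contradiction i ¬i

    Out⇒out : ∀ {x} → Out x → lab x ≡ out
    Out⇒out {x} o with em {In x} | em {Out x}
    -- `label` tests `In` first, so only disjointness keeps an `Out` point from being labelled
    -- `inn`.
    ... | yes i | _     = contradiction o (In-Out-disjoint i)
    ... | no _  | yes _ = refl
    ... | no _  | no ¬o = contradiction o ¬o

    inn⇒In : ∀ {x} → lab x ≡ inn → In x
    inn⇒In {x} eq with em {In x} | em {Out x}
    inn⇒In _  | yes i | _     = i
    inn⇒In () | no _  | yes _
    inn⇒In () | no _  | no _

    out⇒Out : ∀ {x} → lab x ≡ out → Out x
    out⇒Out {x} eq with em {In x} | em {Out x}
    out⇒Out () | yes _ | _
    out⇒Out _  | no _  | yes o = o
    out⇒Out () | no _  | no _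

    ≢inn∧≢out⇒und : ∀ {l} → l ≢ inn → l ≢ out → l ≡ und
    ≢inn∧≢out⇒und {inn} l≢inn _ = contradiction refl l≢inn
    ≢inn∧≢out⇒und {out} _ l≢out = contradiction refl l≢out
    ≢inn∧≢out⇒und {und} _ _     = refl

    ≢out⇒inn⊎und : ∀ {l} → l ≢ out → l ≡ inn ⊎ l ≡ und
    ≢out⇒inn⊎und {inn} _     = inj₁ refl
    ≢out⇒inn⊎und {out} l≢out = contradiction refl l≢out
    ≢out⇒inn⊎und {und} _     = inj₂ refl

    inn⊎und⇒≢out : ∀ {l} → l ≡ inn ⊎ l ≡ und → l ≢ out
    inn⊎und⇒≢out (inj₁ refl) ()
    inn⊎und⇒≢out (inj₂ refl) ()

    -- Contrapositive of `defeated`: an attacking set without such a `y` would lie wholly in `In`.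
    -- Excluded middle supplies the witness.
    not-Out⇒some-≢inn : ∀ {x} → ¬ Out x →
      ∀ G → R₀ G x → ∃[ y ] (y ∈ G × lab y ≢ inn)
    not-Out⇒some-≢inn ¬o G Gx = dne-small λ none →
      ¬o (defeated G Gx λ y y∈G → dne λ ¬i → none (y , y∈G , ¬i ∘ inn⇒In))

    -- Contrapositive of `defended`: were there no such `G`, every attacking set would contain an
    -- `Out` element.
    not-In⇒undefended : ∀ {x} → ¬ In x →
      ∃[ G ] (R₀ G x × (∀ y → y ∈ G → lab y ≡ inn ⊎ lab y ≡ und))
    not-In⇒undefended ¬i = dne λ none →
      ¬i (defended λ G Gx → dne λ no-out →
        none (G , Gx , λ y y∈G →
          ≢out⇒inn⊎und λ eq → no-out (y , y∈G , out⇒Out eq)))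

    lab-legitimate : IsLegitimate 𝒜 lab
    lab-legitimate = record
      -- The right disjunct always serves, as it holds vacuously for unattacked points.
      { CG1 = λ x → mk⇔ (inj₂ ∘ cg1 ∘ inn⇒In) (In⇒inn ∘ cg1⁻¹)
      ; CG2 = λ x → mk⇔ (cg2 ∘ out⇒Out)
          (λ (G , Gx , all-inn) →
            Out⇒out (defeated G Gx λ y y∈G → inn⇒In (all-inn y y∈G)))
      ; CG3 = λ x → mk⇔
          (λ eq →
              not-Out⇒some-≢inn (λ o → contradiction (trans (sym eq) (Out⇒out o)) λ ())
            , not-In⇒undefended (λ i → contradiction (trans (sym eq) (In⇒inn i)) λ ()))
          cg3⁻¹
      }
      where
      cg1 : ∀ {x} → In x → ∀ G → R₀ G x → ∃[ y ] (y ∈ G × lab y ≡ out)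
      cg1 (defended f) G Gx with f G Gx
      ... | y , y∈G , o = y , y∈G , Out⇒out o

      cg1⁻¹ : ∀ {x} →
        (¬ (∃[ G ] R₀ G x)) ⊎ (∀ G → R₀ G x → ∃[ y ] (y ∈ G × lab y ≡ out)) → In x
      cg1⁻¹ (inj₁ unattacked) = defended λ G Gx → contradiction (G , Gx) unattacked
      cg1⁻¹ (inj₂ f) = defended λ G Gx →
        let y , y∈G , eq = f G Gx in y , y∈G , out⇒Out eq

      cg2 : ∀ {x} → Out x → ∃[ G ] (R₀ G x × (∀ y → y ∈ G → lab y ≡ inn))
      cg2 (defeated G Gx g) = G , Gx , λ y y∈G → In⇒inn (g y y∈G)

      cg3⁻¹ : ∀ {x} →
        (∀ G → R₀ G x → ∃[ y ] (y ∈ G × lab y ≢ inn)) ×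
        (∃[ G ] (R₀ G x × (∀ y → y ∈ G → lab y ≡ inn ⊎ lab y ≡ und))) →
        lab x ≡ und
      -- Each conjunct excludes one label: `H` has no `out` element, which forbids `inn`, and
      -- `some-≢inn` meets every attacking set, which forbids `out`.
      cg3⁻¹ (some-≢inn , H , Hx , no-out) = ≢inn∧≢out⇒und
        (λ eq → let y , y∈H , y-out = cg1 (inn⇒In eq) H Hx in
          inn⊎und⇒≢out (no-out y y∈H) y-out)
        (λ eq → let G , Gx , all-inn = cg2 (out⇒Out eq)
                    y , y∈G , y≢inn = some-≢inn G Gx in
          y≢inn (all-inn y y∈G))

theorem21 : ∀ {a ℓ r : Level} → ExcludedMiddle (a ⊔ suc ℓ ⊔ r) →
    (𝒜 : JointAttackNetwork a ℓ r) →
    ∃[ lab ] IsLegitimate 𝒜 lab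
theorem21 em 𝒜 = lab em , lab-legitimate em
  where open Grounded 𝒜
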